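{- Let $\frac{1}{2}\leq \alpha <1$ and let $G$ be a graph with $n$ vertices and $m$ edges. If $1\leq k\leq n-1$, then $$S_{k}(A_{\alpha}(G))\leq \frac{2\alpha km}{n}+\sqrt{\frac{k(n-k)}{n}\left(\alpha^2Z_1+2m(1-\alpha)^2-\frac{4\alpha^2m^2}{n}\right)},$$ where $Z_1$ is the first Zagreb index of $G$.
   Context: All graphs are simple and undirected. $A_{\alpha}(G)=\alpha D(G)+(1-\alpha)A(G)$, where $A(G)$ is the adjacency matrix and $D(G)$ the diagonal matrix of vertex degrees. For a real symmetric matrix $M$ with eigenvalues $\lambda_1(M)\geq\cdots\geq\lambda_n(M)$, $S_k(M)=\sum_{i=1}^k\lambda_i(M)$. The first Zagreb index $Z_1=Z_1(G)=\sum_{v\in V(G)} d_v^2$ is the sum of the squares of the vertex degrees. -}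

module Defs where

open import Level using (0ℓ; _⊔_) renaming (suc to lsuc)
open import Algebra.Bundles using (CommutativeRing; Semiring)
open import Algebra.Apartness.Bundles using (HeytingField; HeytingCommutativeRing)
import Algebra.Apartness.Properties.HeytingCommutativeRing as HeytingProperties
import Algebra.Definitions.RawSemiring as RawSemiringDefinitions
import Algebra.Properties.Ring as RingProperties
import Algebra.Properties.Semiring.Sum as SemiringSum
open import Data.Bool.Base using (if_then_else_)
open import Data.Fin.Base as Fin using (Fin; zero; suc; toℕ; punchIn)
import Data.Fin.Properties as Fin
open import Data.List.Base using (List; length; filter; allFin; cartesianProduct)
open import Data.Nat.Base as ℕ using (ℕ; zero; suc; NonZero)
import Data.Nat.Properties as ℕ
open import Data.Product.Base using (_×_; _,_; proj₁; ∃-syntax)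
open import Data.Sum.Base using (_⊎_; inj₁; inj₂)
open import Data.Vec.Functional using (Vector)
open import Relation.Binary.Core using (Rel)
open import Relation.Binary.Definitions using (Decidable; Symmetric; Irreflexive)
open import Relation.Binary.PropositionalEquality.Core using (_≡_)
open import Relation.Binary.Structures using (IsStrictPartialOrder)
open import Relation.Nullary.Decidable.Core using (does; _×-dec_)
open import Relation.Nullary.Negation.Core using (¬_)

-- The real numbers, given axiomatically as a Cauchy-complete Archimedean
-- ordered field; classically these axioms determine ℝ up to isomorphism.
-- They are phrased so that they also hold constructively (for instance for
-- regular Cauchy sequences of rationals): the order is not assumed
-- decidable, and x ≤ y means that y < x is impossible.

record Reals c ℓ₁ ℓ₂ ℓ₃ : Set (lsuc (c ⊔ ℓ₁ ⊔ ℓ₂ ⊔ ℓ₃)) where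
  field
    heytingField : HeytingField c ℓ₁ ℓ₂

  open HeytingField heytingField public renaming (zero to *-zero)
  open HeytingCommutativeRing heytingCommutativeRing public
    using (commutativeRing)
  open CommutativeRing commutativeRing public
    using (semiring; ring)
  open RawSemiringDefinitions (Semiring.rawSemiring semiring) public
    using (_^_; product) renaming (_×_ to _·_)
  open SemiringSum semiring public using (sum)

  infix 4 _<_ _≤_

  field
    _<_                  : Rel Carrier ℓ₃
    isStrictPartialOrder : IsStrictPartialOrder _≈_ _<_
    <⇒#                  : ∀ {x y} → x < y → x # y
    #⇒<⊎>                : ∀ {x y} → x # y → x < y ⊎ y < x
    +-monoˡ-<            : ∀ z {x y} → x < y → x + z < y + z
    *-pos                : ∀ {x y} → 0# < x → 0# < y → 0# < x * y

  _≤_ : Rel Carrier ℓ₃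
  x ≤ y = ¬ (y < x)

  ι : ℕ → Carrier
  ι n = n · 1#

  IsCauchy : (ℕ → Carrier) → Set (c ⊔ ℓ₃)
  IsCauchy u = ∀ ε → 0# < ε →
    ∃[ N ] (∀ m n → N ℕ.≤ m → N ℕ.≤ n → u m - u n < ε)

  ConvergesTo : (ℕ → Carrier) → Carrier → Set (c ⊔ ℓ₃)
  ConvergesTo u l = ∀ ε → 0# < ε →
    ∃[ N ] (∀ n → N ℕ.≤ n → (u n - l < ε) × (l - u n < ε))

  field
    archimedean : ∀ x → ∃[ n ] x < ι n
    complete    : ∀ u → IsCauchy u → ∃[ l ] ConvergesTo u l

  -- On non-negative arguments these properties determine √ uniquely, and
  -- its existence there follows from completeness. Nothing is assumed about
  -- the value of √ at a negative argument.
  field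
    √        : Carrier → Carrier
    √-nonNeg : ∀ {x} → 0# ≤ x → 0# ≤ √ x
    √-square : ∀ {x} → 0# ≤ x → √ x * √ x ≈ x

  private
    module SPO = IsStrictPartialOrder isStrictPartialOrder
    open HeytingProperties heytingCommutativeRing using (1#0)
    open RingProperties ring using (-1*x≈-x; -‿involutive)

  0<1 : 0# < 1#
  0<1 with #⇒<⊎> 1#0
  ... | inj₂ 0<1 = 0<1
  ... | inj₁ 1<0 = SPO.<-respʳ-≈ -1*-1≈1 (*-pos 0<-1 0<-1)
    where
    0<-1 : 0# < - 1#
    0<-1 = SPO.<-respˡ-≈ (-‿inverseʳ 1#)
             (SPO.<-respʳ-≈ (+-identityˡ (- 1#)) (+-monoˡ-< (- 1#) 1<0))

    -1*-1≈1 : - 1# * - 1# ≈ 1#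
    -1*-1≈1 = trans (-1*x≈-x (- 1#)) (-‿involutive 1#)

  ι-pos : ∀ n .{{_ : NonZero n}} → 0# < ι n
  ι-pos (suc zero)    = SPO.<-respʳ-≈ (sym (+-identityʳ 1#)) 0<1
  ι-pos (suc (suc n)) = SPO.trans (ι-pos (suc n))
    (SPO.<-respˡ-≈ (+-identityˡ (ι (suc n))) (+-monoˡ-< (ι (suc n)) 0<1))

  infixl 7 _/ℕ_

  -- The library provides inverses of differences of apart elements; here
  -- the difference is ι n - 0#.
  _/ℕ_ : Carrier → (n : ℕ) .{{_ : NonZero n}} → Carrier
  x /ℕ n = x * proj₁ (#⇒invertible (#-sym (<⇒# (ι-pos n))))

record Graph (n : ℕ) : Set₁ where
  field
    Adj    : Rel (Fin n) 0ℓ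
    adj?   : Decidable Adj
    sym    : Symmetric Adj
    irrefl : Irreflexive _≡_ Adj

  degree : Fin n → ℕ
  degree v = length (filter (adj? v) (allFin n))

  -- Each edge is listed once, with its smaller endpoint first.
  edges : List (Fin n × Fin n)
  edges = filter (λ (u , v) → (u Fin.<? v) ×-dec adj? u v)
                 (cartesianProduct (allFin n) (allFin n))

  size : ℕ
  size = length edges

  firstZagreb : ℕ
  firstZagreb = SemiringSum.sum ℕ.+-*-semiring (λ v → degree v ℕ.^ 2)

module RealMatrices {c ℓ₁ ℓ₂ ℓ₃} (R : Reals c ℓ₁ ℓ₂ ℓ₃) where
  open Reals R

  SquareMatrix : ℕ → Set c
  SquareMatrix n = Fin n → Fin n → Carrier

  diagonal : ∀ {n} → Vector Carrier n → SquareMatrix n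
  diagonal d i j = if does (i Fin.≟ j) then d i else 0#

  -- Laplace expansion along the first row.
  det : ∀ {n} → SquareMatrix n → Carrier
  det {zero}  M = 1#
  det {suc n} M = sum λ j →
    (- 1#) ^ toℕ j * M zero j * det (λ i k → M (suc i) (punchIn j k))

  charPoly : ∀ {n} → SquareMatrix n → Carrier → Carrier
  charPoly M x = det (λ i j → diagonal (λ _ → x) i j - M i j)

  -- The eigenvalues listed with multiplicity, as the roots of the
  -- characteristic polynomial, in non-increasing order. Polynomials over the
  -- infinite field R agree when they agree as functions.
  record Eigenvalues {n} (M : SquareMatrix n) (λs : Vector Carrier n)
         : Set (c ⊔ ℓ₁ ⊔ ℓ₃) where
    field
      factorises    : ∀ x → charPoly M x ≈ product (λ i → x - λs i)
      nonIncreasing : ∀ {i j} → i Fin.≤ j → λs j ≤ λs i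

  -- For M with eigenvalues λs, S k λs is S_k(M). The entry called λ₁ in
  -- mathematical notation has index 0.
  S : ∀ {n} → ℕ → Vector Carrier n → Carrier
  S k λs = sum λ i → if does (toℕ i ℕ.<? k) then λs i else 0#

  module _ {n} (G : Graph n) where
    open Graph G

    adjacencyMatrix : SquareMatrix n
    adjacencyMatrix i j = if does (adj? i j) then 1# else 0#

    degreeMatrix : SquareMatrix n
    degreeMatrix = diagonal (λ v → ι (degree v))

    A[_] : Carrier → SquareMatrix n
    A[ α ] i j = α * degreeMatrix i j + (1# - α) * adjacencyMatrix i j

-- Comparing the two top non-trivial coefficients of det (x − A_α) and of
-- ∏ (x − λᵢ) gives Σ λᵢ = tr A_α = 2αm and
-- Σ λᵢ² = tr A_α² = α² Z₁ + 2m (1 − α)². Since S_k − (k/n) Σ λᵢ is the inner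
-- product of the centred vectors (χ_{i<k} − k/n)ᵢ and (λᵢ − (Σ λ)/n)ᵢ, whose
-- square norms are k (n − k)/n and Σ λᵢ² − (Σ λᵢ)²/n, the bound is
-- Cauchy–Schwarz.

module Submission where

open import Defs
open import Algebra.Bundles using (CommutativeRing; RawRing)
import Algebra.Properties.Ring as RingProperties
import Algebra.Properties.Semiring.Mult as SemiringMult
import Algebra.Properties.Semiring.Sum as SemiringSum
import Algebra.Solver.Ring as RingSolver
open import Algebra.Solver.Ring.AlmostCommutativeRing
  using (_-Raw-AlmostCommutative⟶_; fromCommutativeRing)
open import Data.Bool.Base using (Bool; true; false; _∧_; if_then_else_)
open import Data.Fin.Base as Fin using (Fin; zero; suc; toℕ; punchIn)
import Data.Fin.Properties as Fin
open import Data.Integer.Base as ℤ using (ℤ; -[1+_]) renaming (+_ to pos)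
import Data.Integer.Properties as ℤ
open import Data.List.Base as List using (length; filter; cartesianProduct)
import Data.List.Properties as List
open import Data.Maybe.Base using (map)
open import Data.Nat.Base as ℕ using (ℕ; zero; suc; NonZero; _∸_)
import Data.Nat.Properties as ℕ
open import Data.Product.Base using (_×_; _,_; proj₁; proj₂; ∃-syntax)
open import Data.Sum.Base using (_⊎_; inj₁; inj₂)
open import Data.Vec.Functional using (Vector)
open import Function.Base using (_∘_)
open import Level using (_⊔_)
open import Relation.Binary.Definitions using (tri<; tri≈; tri>)
open import Relation.Binary.PropositionalEquality.Core as ≡ using (_≡_; _≢_)
open import Relation.Binary.Structures using (IsStrictPartialOrder)
open import Relation.Nullary.Decidable
  using (Dec; does; yes; no; dec-true; dec-false; dec⇒maybe; _×-dec_)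
open import Relation.Nullary.Negation.Core using (¬_; contradiction)
open import Relation.Unary using (Decidable)

-- The coefficient comparison has to start from functions: `factorises` is an equality of values,
-- and `det` is only a Laplace expansion along the first row. Hence the top coefficients of det (x +
-- N) are isolated by bounding the degree of the remainder, and a polynomial function vanishing on a
-- ray is shown to have top coefficient zero. In the expansion of an (n + 1) × (n + 1) determinant
-- det (x + N), the cofactor of the corner entry is again of the form det (x + N′). The minor
-- belonging to column j + 1 is not: besides the x of row 0 it has lost the x of row j + 1, so its
-- degree is at most n - 1, and its coefficient there is N (j + 1) 0 up to sign. These minors are
-- the source of the products N 0 (j + 1) · N (j + 1) 0 in the second coefficient, and controlling
-- them is the main work with determinants. The order is not decidable, so sign arguments go through
-- cotransitivity and tightness of apartness.

-- Ring identities over the reals with integer coefficients.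

module IntegerCoefficients {c ℓ} (CR : CommutativeRing c ℓ) where
  open CommutativeRing CR
  open RingProperties ring
  open SemiringMult semiring using (×-homo-+; ×1-homo-*) renaming (_×_ to _·_)
  open import Relation.Binary.Reasoning.Setoid setoid

  -- Equality of reals is undecidable, so the coefficients of the solver live in ℤ, where
  -- cancellation can be decided. Sending `pos n` to `n · 1#` makes `con (pos n)` denote `ι n`
  -- definitionally.
  fromℤ : ℤ → Carrier
  fromℤ (pos n)    = n · 1#
  fromℤ (-[1+ n ]) = - (suc n · 1#)

  fromℤ-cong : ∀ {i j} → i ≡ j → fromℤ i ≈ fromℤ j
  fromℤ-cong ≡.refl = refl

  fromℤ-neg : ∀ i → fromℤ (ℤ.- i) ≈ - fromℤ i
  fromℤ-neg (pos zero)    = sym -0#≈0#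
  fromℤ-neg (pos (suc n)) = refl
  fromℤ-neg -[1+ n ]      = sym (-‿involutive _)

  fromℤ-⊖ : ∀ m n → fromℤ (m ℤ.⊖ n) ≈ m · 1# - n · 1#
  fromℤ-⊖ m zero = begin
    fromℤ (m ℤ.⊖ 0) ≈⟨ sym (+-identityʳ _) ⟩
    m · 1# + 0#     ≈⟨ +-congˡ (sym -0#≈0#) ⟩
    m · 1# - 0#     ∎
  fromℤ-⊖ zero (suc n) = sym (+-identityˡ _)
  fromℤ-⊖ (suc m) (suc n) = begin
    fromℤ (suc m ℤ.⊖ suc n)           ≈⟨ fromℤ-cong (ℤ.[1+m]⊖[1+n]≡m⊖n m n) ⟩
    fromℤ (m ℤ.⊖ n)                   ≈⟨ fromℤ-⊖ m n ⟩
    m · 1# - n · 1#                   ≈⟨ sym (+-congʳ (+-identityʳ _)) ⟩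
    m · 1# + 0# - n · 1#              ≈⟨ +-congʳ (+-congˡ (sym (-‿inverseʳ 1#))) ⟩
    m · 1# + (1# - 1#) - n · 1#       ≈⟨ +-congʳ (sym (+-assoc _ _ _)) ⟩
    m · 1# + 1# - 1# - n · 1#         ≈⟨ +-assoc _ _ _ ⟩
    m · 1# + 1# + (- 1# - n · 1#)     ≈⟨ +-cong (+-comm _ _) (-‿+-comm _ _) ⟩
    suc m · 1# - suc n · 1#           ∎

  fromℤ-+ : ∀ i j → fromℤ (i ℤ.+ j) ≈ fromℤ i + fromℤ j
  fromℤ-+ (pos m)  (pos n)  = ×-homo-+ 1# m n
  fromℤ-+ (pos m)  -[1+ n ] = fromℤ-⊖ m (suc n)
  fromℤ-+ -[1+ m ] (pos n)  = trans (fromℤ-⊖ n (suc m)) (+-comm _ _)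
  fromℤ-+ -[1+ m ] -[1+ n ] = begin
    - (suc (suc (m ℕ.+ n)) · 1#)      ≈⟨ -‿cong (+-congˡ (×-homo-+ 1# (suc m) n)) ⟩
    - (1# + (suc m · 1# + n · 1#))    ≈⟨ -‿cong (+-congˡ (+-comm _ _)) ⟩
    - (1# + (n · 1# + suc m · 1#))    ≈⟨ -‿cong (sym (+-assoc _ _ _)) ⟩
    - (suc n · 1# + suc m · 1#)       ≈⟨ -‿cong (+-comm _ _) ⟩
    - (suc m · 1# + suc n · 1#)       ≈⟨ sym (-‿+-comm _ _) ⟩
    - (suc m · 1#) - suc n · 1#       ∎

  fromℤ-pos-* : ∀ m j → fromℤ (pos m ℤ.* j) ≈ fromℤ (pos m) * fromℤ j
  fromℤ-pos-* m (pos n) = begin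
    fromℤ (pos m ℤ.* pos n) ≈⟨ fromℤ-cong (≡.sym (ℤ.pos-* m n)) ⟩
    (m ℕ.* n) · 1#          ≈⟨ ×1-homo-* m n ⟩
    m · 1# * n · 1#         ∎
  fromℤ-pos-* m -[1+ n ] = begin
    fromℤ (pos m ℤ.* -[1+ n ])          ≈⟨ fromℤ-cong (≡.sym (ℤ.neg-distribʳ-* (pos m) (pos (suc n)))) ⟩
    fromℤ (ℤ.- (pos m ℤ.* pos (suc n))) ≈⟨ fromℤ-neg (pos m ℤ.* pos (suc n)) ⟩
    - fromℤ (pos m ℤ.* pos (suc n))     ≈⟨ -‿cong (fromℤ-pos-* m (pos (suc n))) ⟩
    - (m · 1# * suc n · 1#)             ≈⟨ -‿distribʳ-* _ _ ⟩
    m · 1# * - (suc n · 1#)             ∎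

  fromℤ-* : ∀ i j → fromℤ (i ℤ.* j) ≈ fromℤ i * fromℤ j
  fromℤ-* (pos m) j  = fromℤ-pos-* m j
  fromℤ-* -[1+ m ] j = begin
    fromℤ (-[1+ m ] ℤ.* j)          ≈⟨ fromℤ-cong (≡.sym (ℤ.neg-distribˡ-* (pos (suc m)) j)) ⟩
    fromℤ (ℤ.- (pos (suc m) ℤ.* j)) ≈⟨ fromℤ-neg (pos (suc m) ℤ.* j) ⟩
    - fromℤ (pos (suc m) ℤ.* j)     ≈⟨ -‿cong (fromℤ-pos-* (suc m) j) ⟩
    - (suc m · 1# * fromℤ j)        ≈⟨ -‿distribˡ-* _ _ ⟩
    - (suc m · 1#) * fromℤ j        ∎

  ℤ-rawRing : RawRing _ _
  ℤ-rawRing = record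
    { _≈_ = _≡_ ; _+_ = ℤ._+_ ; _*_ = ℤ._*_ ; -_ = ℤ.-_ ; 0# = ℤ.0ℤ ; 1# = ℤ.1ℤ }

  morphism : ℤ-rawRing -Raw-AlmostCommutative⟶ fromCommutativeRing CR
  morphism = record
    { ⟦_⟧    = fromℤ
    ; +-homo = fromℤ-+
    ; *-homo = fromℤ-*
    ; -‿homo = fromℤ-neg
    ; 0-homo = refl
    ; 1-homo = +-identityʳ 1#
    }

  open RingSolver ℤ-rawRing (fromCommutativeRing CR) morphism
    (λ i j → map fromℤ-cong (dec⇒maybe (i ℤ.≟ j))) public
    using (Polynomial; solve; _:=_; con; _:+_; _:*_; _:-_; :-_; _:^_)


  -- The coefficient 1 denotes 1# + 0#; the empty power denotes 1# itself.
  :1 : ∀ {n} → Polynomial n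
  :1 = con (pos 0) :^ 0

-- Polynomial functions: degree bounds and uniqueness of top coefficients.

module Polynomials {c ℓ₁ ℓ₂ ℓ₃} (R : Reals c ℓ₁ ℓ₂ ℓ₃) where
  open Reals R
  open IntegerCoefficients commutativeRing
  open IsStrictPartialOrder isStrictPartialOrder using (<-respʳ-≈; <-respˡ-≈)
    renaming (trans to <-trans)
  open import Relation.Binary.Reasoning.Setoid setoid

  -- Degree less than `d`, as a Horner scheme. It is a property of the function, so it transfers
  -- along pointwise equality, and leading coefficients may vanish.
  Poly< : ℕ → (Carrier → Carrier) → Set (c ⊔ ℓ₁)
  Poly< zero    f = ∀ x → f x ≈ 0#
  Poly< (suc d) f = ∃[ a ] ∃[ g ] Poly< d g × (∀ x → f x ≈ a + x * g x)

  private variable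
    d : ℕ
    f g : Carrier → Carrier

  Poly<-cong : (∀ x → f x ≈ g x) → Poly< d f → Poly< d g
  Poly<-cong {d = zero}  f≈g p               x = trans (sym (f≈g x)) (p x)
  Poly<-cong {d = suc _} f≈g (a , h , p , e) =
    a , h , p , λ x → trans (sym (f≈g x)) (e x)

  Poly<-0 : ∀ d → Poly< d (λ _ → 0#)
  Poly<-0 zero    x = refl
  Poly<-0 (suc d) = 0# , (λ _ → 0#) , Poly<-0 d ,
    solve 1 (λ x → con (pos 0) := con (pos 0) :+ x :* con (pos 0)) refl

  Poly<-const : ∀ a → Poly< (suc d) (λ _ → a)
  Poly<-const {d} a = a , (λ _ → 0#) , Poly<-0 d ,
    λ x → solve 2 (λ a x → a := a :+ x :* con (pos 0)) refl a x

  Poly<-+ : Poly< d f → Poly< d g → Poly< d (λ x → f x + g x)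
  Poly<-+ {zero}  p q x = trans (+-cong (p x) (q x)) (+-identityʳ 0#)
  Poly<-+ {suc d} (a , f , p , e) (b , g , q , e′) =
    a + b , (λ x → f x + g x) , Poly<-+ p q , λ x →
      trans (+-cong (e x) (e′ x))
        (solve 5 (λ a b f g x → a :+ x :* f :+ (b :+ x :* g) :=
                                a :+ b :+ x :* (f :+ g)) refl a b (f x) (g x) x)

  Poly<-*ˡ : ∀ a → Poly< d f → Poly< d (λ x → a * f x)
  Poly<-*ˡ {zero}  a p x = trans (*-congˡ (p x)) (zeroʳ a)
  Poly<-*ˡ {suc d} a (b , f , p , e) =
    a * b , (λ x → a * f x) , Poly<-*ˡ a p , λ x →
      trans (*-congˡ (e x))
        (solve 4 (λ a b f x → a :* (b :+ x :* f) := a :* b :+ x :* (a :* f))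
          refl a b (f x) x)

  Poly<-suc : Poly< d f → Poly< (suc d) f
  Poly<-suc {zero}  p = 0# , (λ _ → 0#) , Poly<-0 0 , λ x →
    trans (p x) (solve 1 (λ x → con (pos 0) := con (pos 0) :+ x :* con (pos 0)) refl x)
  Poly<-suc {suc d} (a , f , p , e) = a , f , Poly<-suc p , e

  Poly<-shift : Poly< d f → Poly< (suc d) (λ x → x * f x)
  Poly<-shift {f = f} p = 0# , f , p , λ x → sym (+-identityˡ (x * f x))

  Poly<-^ : ∀ d → Poly< (suc d) (λ x → x ^ d)
  Poly<-^ zero    = Poly<-const 1#
  Poly<-^ (suc d) = Poly<-shift (Poly<-^ d)

  Poly<-*₁ : Poly< 1 f → Poly< d g → Poly< d (λ x → f x * g x)
  Poly<-*₁ {g = g} (a , h , h≈0 , e) q = Poly<-cong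
    (λ x → *-congʳ (sym (trans (e x) (trans (+-congˡ (trans (*-congˡ (h≈0 x)) (zeroʳ x)))
                                            (+-identityʳ a)))))
    (Poly<-*ˡ a q)

  Poly<-*₂ : Poly< 2 f → Poly< d g → Poly< (suc d) (λ x → f x * g x)
  Poly<-*₂ {g = g} (a , h , p , e) q = Poly<-cong
    (λ x → trans (solve 4 (λ a x h g → a :* g :+ x :* (h :* g) :=
                                       (a :+ x :* h) :* g) refl a x (h x) (g x))
                 (*-congʳ (sym (e x))))
    (Poly<-+ (Poly<-suc (Poly<-*ˡ a q)) (Poly<-shift (Poly<-*₁ p q)))

  Poly<-sum : ∀ {n} {F : Fin n → Carrier → Carrier} → (∀ i → Poly< d (F i)) →
              Poly< d (λ x → sum (λ i → F i x))
  Poly<-sum {d} {zero}  p = Poly<-0 d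
  Poly<-sum {d} {suc n} p = Poly<-+ (p zero) (Poly<-sum (p ∘ suc))

  -- Degree at most `d`, with the coefficient `c` of x^d, possibly zero, exposed; `Poly<` hides all
  -- coefficients existentially.
  HasTop : ℕ → Carrier → (Carrier → Carrier) → Set (c ⊔ ℓ₁)
  HasTop zero    c f = ∀ x → f x ≈ c
  HasTop (suc d) c f = ∃[ a ] ∃[ g ] HasTop d c g × (∀ x → f x ≈ a + x * g x)

  hasTop : ∀ c → Poly< d f → HasTop d c (λ x → c * x ^ d + f x)
  hasTop {zero} c p x = trans (+-congˡ (p x))
    (solve 1 (λ c → c :* :1 :+ con (pos 0) := c) refl c)
  hasTop {suc d} c (a , g , p , e) =
    a , (λ x → c * x ^ d + g x) , hasTop c p , λ x → trans (+-congˡ (e x))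
      (solve 5 (λ a c g x y → c :* (x :* y) :+ (a :+ x :* g) :=
                              a :+ x :* (c :* y :+ g)) refl a c (g x) x (x ^ d))

  -- Horner's rule: for f = a + x g, the difference f x - f r is (x - r) g r + x (g x - g r), and
  -- the recursion divides the last bracket. The quotient inherits the top coefficient.
  synthetic-division : ∀ {c} → HasTop (suc d) c f → ∀ r →
    ∃[ q ] HasTop d c q × (∀ x → f x - f r ≈ (x - r) * q x)
  synthetic-division {zero} {f} {c} (a , g , g≈c , e) r = (λ _ → c) , (λ _ → refl) , λ x → begin
    f x - f r                      ≈⟨ +-cong (e x) (-‿cong (e r)) ⟩
    a + x * g x - (a + r * g r)    ≈⟨ +-cong (+-congˡ (*-congˡ (g≈c x)))
                                        (-‿cong (+-congˡ (*-congˡ (g≈c r)))) ⟩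
    a + x * c - (a + r * c)        ≈⟨ solve 4 (λ a c x r → a :+ x :* c :- (a :+ r :* c) :=
                                                           (x :- r) :* c) refl a c x r ⟩
    (x - r) * c                    ∎
  synthetic-division {suc d} {f} (a , g , top , e) r
    with synthetic-division top r
  ... | q , q-top , e′ = (λ x → g r + x * q x) , (g r , q , q-top , λ _ → refl) , λ x → begin
    f x - f r                          ≈⟨ +-cong (e x) (-‿cong (e r)) ⟩
    a + x * g x - (a + r * g r)        ≈⟨ solve 5 (λ a g h x r → a :+ x :* g :- (a :+ r :* h) :=
                                            (x :- r) :* h :+ x :* (g :- h)) refl a (g x) (g r) x r ⟩
    (x - r) * g r + x * (g x - g r)    ≈⟨ +-congˡ (*-congˡ (e′ x)) ⟩
    (x - r) * g r + x * ((x - r) * q x) ≈⟨ solve 4 (λ h q x r → (x :- r) :* h :+ x :* ((x :- r) :* q) :=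
                                            (x :- r) :* (h :+ x :* q)) refl (g r) (q x) x r ⟩
    (x - r) * (g r + x * q x)          ∎

  x<x+1 : ∀ x → x < x + 1#
  x<x+1 x = <-respˡ-≈ (+-identityˡ x) (<-respʳ-≈ (+-comm 1# x) (+-monoˡ-< x 0<1))

  *-cancel-# : ∀ {x y z} → x # y → (x - y) * z ≈ 0# → z ≈ 0#
  *-cancel-# {x} {y} {z} x#y xz≈0 with #⇒invertible x#y
  ... | w , w*[x-y]≈1 , _ = begin
    z                   ≈⟨ *-identityˡ z ⟨
    1# * z              ≈⟨ *-congʳ w*[x-y]≈1 ⟨
    w * (x - y) * z     ≈⟨ *-assoc w (x - y) z ⟩
    w * ((x - y) * z)   ≈⟨ *-congˡ xz≈0 ⟩
    w * 0#              ≈⟨ zeroʳ w ⟩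
    0#                  ∎

  -- Dividing by x - r at the root r = s + 1 lowers the degree. The quotient is known to vanish only
  -- where x - r is invertible, so the hypothesis is about a ray, which shrinks from s to r at each
  -- step.
  top-of-zero : ∀ {c} s → HasTop d c f → (∀ x → s < x → f x ≈ 0#) → c ≈ 0#
  top-of-zero {zero}      s top vanishes =
    trans (sym (top (s + 1#))) (vanishes (s + 1#) (x<x+1 s))
  top-of-zero {suc d} {f} s top vanishes with synthetic-division top (s + 1#)
  ... | q , q-top , e = top-of-zero r q-top λ x r<x →
    *-cancel-# (#-sym (<⇒# r<x)) (begin
      (x - r) * q x ≈⟨ e x ⟨
      f x - f r     ≈⟨ +-cong (vanishes x (<-trans (x<x+1 s) r<x)) (-‿cong (vanishes r (x<x+1 s))) ⟩
      0# - 0#       ≈⟨ -‿inverseʳ 0# ⟩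
      0#            ∎)
    where r = s + 1#

  -- Second order expansion at infinity of a monic polynomial function of
  -- degree n; the factor x² makes the definition meaningful for n < 2.
  Expansion : ℕ → (Carrier → Carrier) → Carrier → Carrier → Set (c ⊔ ℓ₁)
  Expansion n f e₁ e₂ = Poly< n λ x →
    x ^ 2 * f x - (x ^ (2 ℕ.+ n) + e₁ * x ^ (1 ℕ.+ n) + e₂ * x ^ n)

  Expansion-cong : ∀ {n e₁ e₂} → (∀ x → f x ≈ g x) →
                   Expansion n f e₁ e₂ → Expansion n g e₁ e₂
  Expansion-cong f≈g = Poly<-cong (λ x → +-congʳ (*-congˡ (f≈g x)))

  -- If ρ is the old remainder, the new one is a ρ + x ρ + a e₂ x^n: the product a · e₂ x^n has
  -- dropped below the recorded terms.
  Expansion-* : ∀ {n e₁ e₂} a → Expansion n f e₁ e₂ →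
    Expansion (suc n) (λ x → (x + a) * f x) (a + e₁) (a * e₁ + e₂)
  Expansion-* {f} {n} {e₁} {e₂} a p = Poly<-cong
    (λ x → solve 6 (λ a x f y e₁ e₂ →
        let r = x :^ 2 :* f :- (x :* (x :* y) :+ e₁ :* (x :* y) :+ e₂ :* y) in
        a :* r :+ x :* r :+ (a :* e₂) :* y :=
        x :^ 2 :* ((x :+ a) :* f) :- (x :* (x :* (x :* y)) :+
          (a :+ e₁) :* (x :* (x :* y)) :+ (a :* e₁ :+ e₂) :* (x :* y)))
      refl a x (f x) (x ^ n) e₁ e₂)
    (Poly<-+ (Poly<-+ (Poly<-suc (Poly<-*ˡ a p)) (Poly<-shift p))
             (Poly<-*ˡ (a * e₂) (Poly<-^ n)))

  -- Subtracting the two remainders eliminates f. The coefficients are compared one after the other,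
  -- since e₂ - e₂′ is the top coefficient only once e₁ - e₁′ is known to vanish.
  Expansion-unique : ∀ {n e₁ e₂ e₁′ e₂′} → Expansion n f e₁ e₂ →
    Expansion n f e₁′ e₂′ → e₁ ≈ e₁′ × e₂ ≈ e₂′
  Expansion-unique {f} {n} {e₁} {e₂} {e₁′} {e₂′} p q = e₁≈e₁′ , e₂≈e₂′
    where
    r r′ : Carrier → Carrier
    r x  = x ^ 2 * f x - (x ^ (2 ℕ.+ n) + e₁ * x ^ (1 ℕ.+ n) + e₂ * x ^ n)
    r′ x = x ^ 2 * f x - (x ^ (2 ℕ.+ n) + e₁′ * x ^ (1 ℕ.+ n) + e₂′ * x ^ n)

    r-r′ : Poly< n (λ x → r x + - 1# * r′ x)
    r-r′ = Poly<-+ p (Poly<-*ˡ (- 1#) q)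

    identity : ∀ x → (e₁ - e₁′) * x ^ (1 ℕ.+ n) +
                     ((e₂ - e₂′) * x ^ n + (r x + - 1# * r′ x)) ≈ 0#
    identity x = solve 7 (λ x f y e₁ e₂ e₁′ e₂′ →
        (e₁ :- e₁′) :* (x :* y) :+ ((e₂ :- e₂′) :* y :+
          ((x :^ 2 :* f :- (x :* (x :* y) :+ e₁ :* (x :* y) :+ e₂ :* y)) :+
           :- :1 :* (x :^ 2 :* f :- (x :* (x :* y) :+ e₁′ :* (x :* y) :+ e₂′ :* y))))
        := con (pos 0))
      refl x (f x) (x ^ n) e₁ e₂ e₁′ e₂′

    x-y≈0⇒x≈y : ∀ {x y} → x - y ≈ 0# → x ≈ y
    x-y≈0⇒x≈y {x} {y} e = trans (solve 2 (λ x y → x := x :- y :+ y) refl x y)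
      (trans (+-congʳ e) (+-identityˡ y))

    e₁-e₁′≈0 : e₁ - e₁′ ≈ 0#
    e₁-e₁′≈0 = top-of-zero 0#
      (hasTop (e₁ - e₁′) (Poly<-+ (Poly<-*ˡ (e₂ - e₂′) (Poly<-^ n)) (Poly<-suc r-r′)))
      (λ x _ → identity x)

    e₁≈e₁′ : e₁ ≈ e₁′
    e₁≈e₁′ = x-y≈0⇒x≈y e₁-e₁′≈0

    e₂≈e₂′ : e₂ ≈ e₂′
    e₂≈e₂′ = x-y≈0⇒x≈y (top-of-zero 0# (hasTop (e₂ - e₂′) r-r′) λ x _ → begin
      (e₂ - e₂′) * x ^ n + (r x + - 1# * r′ x)
        ≈⟨ +-identityˡ _ ⟨
      0# + ((e₂ - e₂′) * x ^ n + (r x + - 1# * r′ x))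
        ≈⟨ +-congʳ (trans (*-congʳ e₁-e₁′≈0) (zeroˡ _)) ⟨
      (e₁ - e₁′) * x ^ (1 ℕ.+ n) + ((e₂ - e₂′) * x ^ n + (r x + - 1# * r′ x))
        ≈⟨ identity x ⟩
      0# ∎)

-- Determinants of x + N, and power sums of eigenvalues as traces.

module CharacteristicPolynomials {c ℓ₁ ℓ₂ ℓ₃} (R : Reals c ℓ₁ ℓ₂ ℓ₃) where
  open Reals R
  open RealMatrices R
  open IntegerCoefficients commutativeRing
  open Polynomials R
  open RingProperties ring using (-‿involutive)
  open SemiringSum semiring
    using (sum-cong-≋; ∑-distrib-+; *-distribˡ-sum; *-distribʳ-sum)
  open import Relation.Binary.Reasoning.Setoid setoid

  diagonal-off : ∀ {n} (d : Vector Carrier n) {i j} → i ≢ j → diagonal d i j ≡ 0#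
  diagonal-off d {i} {j} i≢j with i Fin.≟ j
  ... | yes i≡j = contradiction i≡j i≢j
  ... | no  _   = ≡.refl

  diagonal-on : ∀ {n} (d : Vector Carrier n) i → diagonal d i i ≡ d i
  diagonal-on d i with i Fin.≟ i
  ... | yes _   = ≡.refl
  ... | no  i≢i = contradiction ≡.refl i≢i

  det-cong : ∀ {n} {M N : SquareMatrix n} → (∀ i j → M i j ≈ N i j) → det M ≈ det N
  det-cong {zero}  M≈N = refl
  det-cong {suc n} M≈N = sum-cong-≋ λ j →
    *-cong (*-congˡ {x = (- 1#) ^ toℕ j} (M≈N zero j)) (det-cong λ i k → M≈N (suc i) (punchIn j k))

  MatrixFunction : ℕ → Set c
  MatrixFunction n = Fin n → Fin n → Carrier → Carrier

  det[_] : ∀ {n} → MatrixFunction n → Carrier → Carrier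
  det[ M ] x = det (λ i j → M i j x)

  minor : ∀ {n} → MatrixFunction (suc n) → Fin (suc n) → MatrixFunction n
  minor M j i k = M (suc i) (punchIn j k)

  det-Poly< : ∀ {n} {M : MatrixFunction n} → (∀ i j → Poly< 2 (M i j)) →
              Poly< (suc n) det[ M ]
  det-Poly< {zero}  p = Poly<-const 1#
  det-Poly< {suc n} p = Poly<-sum λ j →
    Poly<-cong (λ x → sym (*-assoc _ _ _))
      (Poly<-*ˡ ((- 1#) ^ toℕ j)
        (Poly<-*₂ (p zero j) (det-Poly< λ i k → p (suc i) (punchIn j k))))

  -- Every product in the determinant takes one factor from each row, so a row free of x costs one
  -- degree compared with `det-Poly<`.
  det-Poly<-row : ∀ {n} {M : MatrixFunction n} → (∀ i j → Poly< 2 (M i j)) →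
                  ∀ r → (∀ j → Poly< 1 (M r j)) → Poly< n det[ M ]
  det-Poly<-row p zero    q = Poly<-sum λ j →
    Poly<-cong (λ x → sym (*-assoc _ _ _))
      (Poly<-*ˡ ((- 1#) ^ toℕ j)
        (Poly<-*₁ (q j) (det-Poly< λ i k → p (suc i) (punchIn j k))))
  det-Poly<-row p (suc r) q = Poly<-sum λ j →
    Poly<-cong (λ x → sym (*-assoc _ _ _))
      (Poly<-*ˡ ((- 1#) ^ toℕ j)
        (Poly<-*₂ (p zero j)
          (det-Poly<-row (λ i k → p (suc i) (punchIn j k)) r (λ k → q (punchIn j k)))))

  -- The matrix x + N. For N = -M it is definitionally the matrix in `charPoly M`; the plus sign
  -- keeps the coefficients free of alternating signs.
  pencil : ∀ {n} → SquareMatrix n → MatrixFunction n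
  pencil N i j x = diagonal (λ _ → x) i j + N i j

  trailing : ∀ {n} → SquareMatrix (suc n) → SquareMatrix n
  trailing N i j = N (suc i) (suc j)

  pencil-off : ∀ {n} (N : SquareMatrix n) {i j} → i ≢ j → ∀ x → pencil N i j x ≈ N i j
  pencil-off N i≢j x = trans (+-congʳ (reflexive (diagonal-off (λ _ → x) i≢j))) (+-identityˡ _)

  Poly<-pencil-off : ∀ {n} (N : SquareMatrix n) {i j} → i ≢ j → Poly< 1 (pencil N i j)
  Poly<-pencil-off N i≢j =
    Poly<-cong (λ x → sym (pencil-off N i≢j x)) (Poly<-const _)

  Poly<-pencil : ∀ {n} (N : SquareMatrix n) i j → Poly< 2 (pencil N i j)
  Poly<-pencil N i j with i Fin.≟ j
  ... | yes _ = Poly<-+ (Poly<-cong (λ x → *-identityʳ x) (Poly<-^ 1)) (Poly<-const _)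
  ... | no  _ = Poly<-+ (Poly<-0 2) (Poly<-const _)

  -- The minors of a pencil along its first row have this shape: a constant
  -- column followed by the columns of a smaller pencil other than column j.
  bordered : ∀ {n} → SquareMatrix (suc n) → Vector Carrier (suc n) → Fin (suc n) →
             MatrixFunction (suc n)
  bordered N u j i zero    x = u i
  bordered N u j i (suc k) x = pencil N i (punchIn j k) x

  module _ {n} (N : SquareMatrix (suc n)) (u : Vector Carrier (suc n)) where

    Poly<-bordered : ∀ j i k → Poly< 2 (bordered N u j i k)
    Poly<-bordered j i zero    = Poly<-const _
    Poly<-bordered j i (suc k) = Poly<-pencil N i (punchIn j k)

    Poly<-bordered-row : ∀ j k → Poly< 1 (bordered N u j j k)
    Poly<-bordered-row j zero    = Poly<-const _
    Poly<-bordered-row j (suc k) = Poly<-pencil-off N (Fin.punchInᵢ≢i j k ∘ ≡.sym)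

  -- Away from the corner the first row is constant, so the crude bound `det-Poly<` on the minors
  -- already puts those terms into the remainder.
  det-pencil-monic : ∀ {n} (N : SquareMatrix n) → Poly< n (λ x → det[ pencil N ] x - x ^ n)
  det-pencil-monic {zero}  N x = -‿inverseʳ 1#
  det-pencil-monic {suc n} N = Poly<-cong
    (λ x → solve 5 (λ a x d y s →
        a :* d :+ x :* (d :- y) :+ s := :1 :* (x :+ a) :* d :+ s :- x :* y)
      refl (N zero zero) x (det[ pencil (trailing N) ] x) (x ^ n) _)
    (Poly<-+ (Poly<-+
      (Poly<-*ˡ (N zero zero) (det-Poly< (Poly<-pencil (trailing N))))
      (Poly<-shift (det-pencil-monic (trailing N))))
      (Poly<-sum λ j → Poly<-cong (λ x → sym (*-assoc _ _ _))
        (Poly<-*ˡ ((- 1#) ^ toℕ (suc j))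
          (Poly<-*₁ (Poly<-pencil-off N λ ())
            (det-Poly< λ i k → Poly<-pencil N (suc i) (punchIn (suc j) k))))))

  -- Row j is constant and each other row contains a single x, so x^n arises only by choosing `u j`
  -- in row j; bringing that row to the top costs the sign (-1)^j. The induction moves j towards the
  -- first row.
  det-bordered : ∀ {n} (N : SquareMatrix (suc n)) u j →
    Poly< n (λ x → det[ bordered N u j ] x - (- 1#) ^ toℕ j * u j * x ^ n)
  det-bordered N u zero = Poly<-cong
    (λ x → solve 4 (λ u d y s →
        u :* (d :- y) :+ s := :1 :* u :* d :+ s :- :1 :* u :* y)
      refl (u zero) (det[ pencil (trailing N) ] x) _ _)
    (Poly<-+
      (Poly<-*ˡ (u zero) (det-pencil-monic (trailing N)))
      (Poly<-sum λ j → Poly<-cong (λ x → sym (*-assoc _ _ _))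
        (Poly<-*ˡ ((- 1#) ^ toℕ (suc j))
          (Poly<-*₁ (Poly<-pencil-off N λ ())
            -- Deleting column j + 1 removes the x of row j + 1, which becomes row j of the minor;
            -- this gains the degree that `det-Poly<` would miss.
            (det-Poly<-row
              (λ i k → Poly<-bordered N u zero (suc i) (punchIn (suc j) k)) j
              (λ { zero    → Poly<-const _
                 ; (suc k) → Poly<-pencil-off N
                     (λ e → Fin.punchInᵢ≢i j k (≡.sym (Fin.suc-injective e))) }))))))
  det-bordered {suc n} N u (suc j) = Poly<-cong
    (λ x → trans (solve 9 (λ u d a x b s v y t →
        u :* d :+ :- :1 :* (a :* b :+ x :* (b :- s :* v :* y)) :+ t :=
        :1 :* u :* d :+ (:- :1 :* :1 :* (x :+ a) :* b :+ t) :- :- :1 :* s :* v :* (x :* y))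
      refl (u zero) (det[ minor (bordered N u (suc j)) zero ] x) (N zero zero) x
           (det[ bordered (trailing N) (u ∘ suc) j ] x) ((- 1#) ^ toℕ j) (u (suc j)) (x ^ n)
           (sum λ k → term k x))
      (+-congʳ (+-congˡ (+-congʳ (*-congˡ (det-cong (bordered-minor x)))))))
    (Poly<-+ (Poly<-+ first second) (Poly<-sum others))
    where
    term : Fin n → Carrier → Carrier
    term k x = (- 1#) ^ toℕ (suc (suc k)) * bordered N u (suc j) zero (suc (suc k)) x *
               det[ minor (bordered N u (suc j)) (suc (suc k)) ] x

    bordered-minor : ∀ x i k → bordered (trailing N) (u ∘ suc) j i k x ≈
                               minor (bordered N u (suc j)) (suc zero) i k x
    bordered-minor x i zero    = refl
    bordered-minor x i (suc k) = refl

    minor-Poly< : ∀ k → Poly< (suc n) det[ minor (bordered N u (suc j)) k ]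
    -- The constant row j + 1 survives as row j of every minor along the first row.
    minor-Poly< k = det-Poly<-row
      (λ i l → Poly<-bordered N u (suc j) (suc i) (punchIn k l)) j
      (λ l → Poly<-bordered-row N u (suc j) (punchIn k l))

    first : Poly< (suc n) (λ x → u zero * det[ minor (bordered N u (suc j)) zero ] x)
    first = Poly<-*ˡ (u zero) (minor-Poly< zero)

    second : Poly< (suc n) (λ x → - 1# *
      (N zero zero * det[ bordered (trailing N) (u ∘ suc) j ] x + x *
        (det[ bordered (trailing N) (u ∘ suc) j ] x - (- 1#) ^ toℕ j * u (suc j) * x ^ n)))
    second = Poly<-*ˡ (- 1#) (Poly<-+
      (Poly<-*ˡ (N zero zero)
        (det-Poly<-row (Poly<-bordered (trailing N) (u ∘ suc) j) j
                       (Poly<-bordered-row (trailing N) (u ∘ suc) j)))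
      (Poly<-shift (det-bordered (trailing N) (u ∘ suc) j)))

    others : ∀ k → Poly< (suc n) (term k)
    others k = Poly<-cong (λ x → sym (*-assoc _ _ _))
      (Poly<-*ˡ ((- 1#) ^ toℕ (suc (suc k)))
        (Poly<-*₁ (Poly<-pencil-off N λ ()) (minor-Poly< (suc (suc k)))))

  trace : ∀ {n} → SquareMatrix n → Carrier
  trace N = sum λ i → N i i

  trace² : ∀ {n} → SquareMatrix n → Carrier
  trace² N = sum λ i → sum λ j → N i j * N j i

  -- The sum of the principal 2 × 2 minors.
  trace₂ : ∀ {n} → SquareMatrix n → Carrier
  trace₂ {zero}  N = 0#
  trace₂ {suc n} N = N zero zero * trace (trailing N) + trace₂ (trailing N) -
                     sum (λ j → N zero (suc j) * N (suc j) zero)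

  trace²-suc : ∀ {n} (N : SquareMatrix (suc n)) → trace² N ≈
    N zero zero * N zero zero + ι 2 * sum (λ j → N zero (suc j) * N (suc j) zero) +
    trace² (trailing N)
  trace²-suc N = begin
    a + s + sum (λ i → N (suc i) zero * N zero (suc i) + t i)
      ≈⟨ +-congˡ (∑-distrib-+ (λ i → N (suc i) zero * N zero (suc i)) t) ⟩
    a + s + (sum (λ i → N (suc i) zero * N zero (suc i)) + sum t)
      ≈⟨ +-congˡ (+-congʳ (sum-cong-≋ λ i → *-comm (N (suc i) zero) (N zero (suc i)))) ⟩
    a + s + (s + sum t)
      ≈⟨ solve 3 (λ a s t → a :+ s :+ (s :+ t) := a :+ con (pos 2) :* s :+ t) refl a s (sum t) ⟩
    a + ι 2 * s + sum t ∎
    where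
    a = N zero zero * N zero zero
    s = sum λ j → N zero (suc j) * N (suc j) zero
    t = λ i → sum λ j → N (suc i) (suc j) * N (suc j) (suc i)

  -- Newton's identity p₂ = e₁² - 2 e₂ for matrices. It lets the power sum be read off from the
  -- first two coefficients.
  trace²≈ : ∀ {n} (N : SquareMatrix n) → trace² N ≈ trace N * trace N - ι 2 * trace₂ N
  trace²≈ {zero}  N = solve 0 (con (pos 0) := con (pos 0) :* con (pos 0) :- con (pos 2) :* con (pos 0)) refl
  trace²≈ {suc n} N = trans (trace²-suc N) (trans (+-congˡ (trace²≈ (trailing N)))
    (solve 4 (λ a s t d → a :* a :+ con (pos 2) :* s :+ (t :* t :- con (pos 2) :* d) :=
        (a :+ t) :* (a :+ t) :- con (pos 2) :* (a :* t :+ d :- s))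
      refl (N zero zero) (sum λ j → N zero (suc j) * N (suc j) zero)
      (trace (trailing N)) (trace₂ (trailing N))))

  -- The minor is `bordered` by the first column of N, so `det-bordered` gives its coefficient in
  -- degree n - 1. The extra factor x avoids writing n - 1.
  det-minor : ∀ {n} (N : SquareMatrix (suc n)) j →
    Poly< n (λ x → x * det[ minor (pencil N) (suc j) ] x - (- 1#) ^ toℕ j * N (suc j) zero * x ^ n)
  det-minor {suc n} N j = Poly<-cong
    (λ x → trans
      (solve 5 (λ x b s v y → x :* (b :- s :* v :* y) := x :* b :- s :* v :* (x :* y))
        refl x (det[ bordered (trailing N) column j ] x) ((- 1#) ^ toℕ j) (column j) (x ^ n))
      (+-congʳ (*-congˡ (det-cong (bordered-minor x)))))
    (Poly<-shift (det-bordered (trailing N) column j))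
    where
    column : Vector Carrier (suc n)
    column i = N (suc i) zero

    bordered-minor : ∀ x i k → bordered (trailing N) column j i k x ≈
                               minor (pencil N) (suc j) i k x
    bordered-minor x i zero    = sym (+-identityˡ _)
    bordered-minor x i (suc k) = refl

  -1^-square : ∀ n → (- 1#) ^ n * (- 1#) ^ n ≈ 1#
  -1^-square zero    = *-identityˡ 1#
  -1^-square (suc n) = trans
    (solve 1 (λ s → :- :1 :* s :* (:- :1 :* s) := s :* s) refl ((- 1#) ^ n))
    (-1^-square n)

  -- The corner term is the factor x + a handled by `Expansion-*`. Every other cofactor term lies
  -- two degrees below the leading one, so it affects only the second coefficient, through -N 0 (j +
  -- 1) · N (j + 1) 0.
  det-expansion : ∀ {n} (N : SquareMatrix n) → Expansion n det[ pencil N ] (trace N) (trace₂ N)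
  det-expansion {zero}  N x =
    solve 1 (λ x → x :^ 2 :* :1 :- (x :* (x :* :1) :+ con (pos 0) :* (x :* :1) :+ con (pos 0) :* :1)
      := con (pos 0)) refl x
  det-expansion {suc n} N = Poly<-cong
    (λ x → trans (+-congˡ (sum-off x))
      (solve 8 (λ x a d t e s y r →
        x :^ 2 :* ((x :+ a) :* d) :- (x :* (x :* (x :* y)) :+ (a :+ t) :* (x :* (x :* y)) :+ (a :* t :+ e) :* (x :* y))
          :+ (x :* x :* r :+ s :* (x :* y)) :=
        x :^ 2 :* (:1 :* (x :+ a) :* d :+ r) :-
          (x :* (x :* (x :* y)) :+ (a :+ t) :* (x :* (x :* y)) :+ (a :* t :+ e :- s) :* (x :* y)))
      refl x a (det[ pencil (trailing N) ] x) (trace (trailing N)) (trace₂ (trailing N))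
        (sum product₀) (x ^ n) (sum λ j → term j x)))
    (Poly<-+ (Expansion-* a (det-expansion (trailing N)))
      (Poly<-sum off-term))
    where
    a = N zero zero

    product₀ : Fin n → Carrier
    product₀ j = N zero (suc j) * N (suc j) zero

    term : Fin n → Carrier → Carrier
    term j x = (- 1#) ^ toℕ (suc j) * pencil N zero (suc j) x * det[ minor (pencil N) (suc j) ] x

    off-term : ∀ j → Poly< (suc n) (λ x → x * x * term j x + product₀ j * (x * x ^ n))
    off-term j = Poly<-cong
      (λ x → begin
        -- The cofactor sign -s meets the sign s of the top coefficient of the minor; as s² = 1,
        -- what remains is -b v for every j.
        x * (- 1# * s * b * (x * m x - s * v * x ^ n))
          ≈⟨ solve 6 (λ x s b m v y →
               x :* (:- :1 :* s :* b :* (x :* m :- s :* v :* y)) :=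
               x :* x :* (:- :1 :* s :* b :* m) :+ s :* s :* (b :* v :* (x :* y)))
             refl x s b (m x) v (x ^ n) ⟩
        x * x * (- 1# * s * b * m x) + s * s * (b * v * (x * x ^ n))
          ≈⟨ +-cong (*-congˡ (*-congʳ (*-congˡ (sym (pencil-off N (λ ()) x)))))
                    (trans (*-congʳ (-1^-square (toℕ j))) (*-identityˡ _)) ⟩
        x * x * term j x + b * v * (x * x ^ n) ∎)
      (Poly<-shift (Poly<-*ˡ (- 1# * s * b) (det-minor N j)))
      where
      s = (- 1#) ^ toℕ j
      b = N zero (suc j)
      v = N (suc j) zero
      m = det[ minor (pencil N) (suc j) ]

    sum-off : ∀ x → sum (λ j → x * x * term j x + product₀ j * (x * x ^ n)) ≈
                    x * x * sum (λ j → term j x) + sum product₀ * (x * x ^ n)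
    sum-off x = trans (∑-distrib-+ (λ j → x * x * term j x) (λ j → product₀ j * (x * x ^ n)))
      (+-cong (sym (*-distribˡ-sum (x * x) (λ j → term j x)))
              (sym (*-distribʳ-sum (x * x ^ n) product₀)))

  -- The second elementary symmetric function stays existential: Newton's identity, carried along,
  -- determines the sum of squares from it.
  product-expansion : ∀ {n} (μ : Vector Carrier n) →
    ∃[ e ] Expansion n (λ x → product (λ i → x + μ i)) (sum μ) e ×
           sum (λ i → μ i * μ i) ≈ sum μ * sum μ - ι 2 * e
  product-expansion {zero} μ = 0# ,
    (solve 1 (λ x → x :^ 2 :* :1 :- (x :* (x :* :1) :+ con (pos 0) :* (x :* :1) :+ con (pos 0) :* :1)
      := con (pos 0)) refl) ,
    solve 0 (con (pos 0) := con (pos 0) :* con (pos 0) :- con (pos 2) :* con (pos 0)) refl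
  product-expansion {suc n} μ with product-expansion (μ ∘ suc)
  ... | e , expansion , squares = μ zero * sum (μ ∘ suc) + e , Expansion-* (μ zero) expansion ,
    trans (+-congˡ squares)
      (solve 3 (λ a t e → a :* a :+ (t :* t :- con (pos 2) :* e) :=
                          (a :+ t) :* (a :+ t) :- con (pos 2) :* (a :* t :+ e))
        refl (μ zero) (sum (μ ∘ suc)) e)

  sum-neg : ∀ {n} (f : Vector Carrier n) → sum (λ i → - f i) ≈ - sum f
  sum-neg f = begin
    sum (λ i → - f i)      ≈⟨ sum-cong-≋ (λ i → solve 1 (λ a → :- a := :- :1 :* a) refl (f i)) ⟩
    sum (λ i → - 1# * f i) ≈⟨ *-distribˡ-sum (- 1#) f ⟨
    - 1# * sum f           ≈⟨ solve 1 (λ a → :- :1 :* a := :- a) refl (sum f) ⟩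
    - sum f                ∎

  module _ {n} {M : SquareMatrix n} {λs : Vector Carrier n} (eigen : Eigenvalues M λs) where
    private
      -M : SquareMatrix n
      -M i j = - M i j

      -λs : Vector Carrier n
      -λs i = - λs i

      e : Carrier
      e = proj₁ (product-expansion -λs)

      coefficients : trace -M ≈ sum -λs × trace₂ -M ≈ e
      -- Both sides of `factorises` are read with plus signs, as the pencil of -M and the product of
      -- the x + (-λᵢ).
      coefficients = Expansion-unique
        (Expansion-cong (Eigenvalues.factorises eigen) (det-expansion -M))
        (proj₁ (proj₂ (product-expansion -λs)))

    sum-eigenvalues : sum λs ≈ trace M
    sum-eigenvalues = begin
      sum λs       ≈⟨ -‿involutive (sum λs) ⟨
      - - sum λs   ≈⟨ -‿cong (sum-neg λs) ⟨
      - sum -λs    ≈⟨ -‿cong (proj₁ coefficients) ⟨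
      - trace -M   ≈⟨ -‿cong (sum-neg (λ i → M i i)) ⟩
      - - trace M  ≈⟨ -‿involutive (trace M) ⟩
      trace M      ∎

    sum-squares-eigenvalues : sum (λ i → λs i * λs i) ≈ trace² M
    sum-squares-eigenvalues = begin
      sum (λ i → λs i * λs i)                    ≈⟨ sum-cong-≋ (λ i → neg-neg (λs i) (λs i)) ⟩
      sum (λ i → -λs i * -λs i)                  ≈⟨ proj₂ (proj₂ (product-expansion -λs)) ⟩
      sum -λs * sum -λs - ι 2 * e                ≈⟨ +-cong (*-cong t t) (-‿cong (*-congˡ (proj₂ coefficients))) ⟨
      trace -M * trace -M - ι 2 * trace₂ -M      ≈⟨ trace²≈ -M ⟨
      trace² -M                                  ≈⟨ sum-cong-≋ (λ i → sum-cong-≋ λ j → neg-neg (M i j) (M j i)) ⟨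
      trace² M                                   ∎
      where
      t = proj₁ coefficients

      neg-neg : ∀ a b → a * b ≈ - a * - b
      neg-neg = solve 2 (λ a b → a :* b := :- a :* :- b) refl

-- Traces of A_α and of its square in terms of degrees and edges.

module GraphMatrices {c ℓ₁ ℓ₂ ℓ₃} (R : Reals c ℓ₁ ℓ₂ ℓ₃) where
  open Reals R
  open RealMatrices R
  open IntegerCoefficients commutativeRing
  open CharacteristicPolynomials R
  open SemiringMult semiring using (×-homo-+; ×1-homo-*)
  open SemiringSum semiring
    using (sum-cong-≋; ∑-distrib-+; ∑-comm; *-distribˡ-sum; sum-replicate-zero)
  open import Relation.Binary.Reasoning.Setoid setoid

  indicator : Bool → Carrier
  indicator b = if b then 1# else 0#

  indicator-*ʳ : ∀ b a → (if b then a else 0#) ≈ indicator b * a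
  indicator-*ʳ true  a = sym (*-identityˡ a)
  indicator-*ʳ false a = sym (zeroˡ a)

  indicator-idem : ∀ b → indicator b * indicator b ≈ indicator b
  indicator-idem true  = *-identityˡ 1#
  indicator-idem false = zeroˡ 0#

  -- Stated for an arbitrary tabulation rather than `allFin`, the case of the identity, because the
  -- tail is tabulated by `f ∘ suc`.
  ι-length-filter : ∀ {a p} {A : Set a} {P : A → Set p} (P? : Decidable P) {n} (f : Fin n → A) →
    ι (length (filter P? (List.tabulate f))) ≈ sum (λ i → indicator (does (P? (f i))))
  ι-length-filter P? {zero}  f = refl
  ι-length-filter P? {suc n} f with does (P? (f zero))
  ... | true  = +-congˡ (ι-length-filter P? (f ∘ suc))
  ... | false = trans (ι-length-filter P? (f ∘ suc)) (sym (+-identityˡ _))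

  ι-length-filter-cartesianProduct :
    ∀ {a b p} {A : Set a} {B : Set b} {P : A × B → Set p} (P? : Decidable P)
    {m n} (f : Fin m → A) (g : Fin n → B) →
    ι (length (filter P? (cartesianProduct (List.tabulate f) (List.tabulate g)))) ≈
    sum (λ i → sum (λ j → indicator (does (P? (f i , g j)))))
  ι-length-filter-cartesianProduct P? {zero}  f g = refl
  ι-length-filter-cartesianProduct P? {suc m} f g = begin
    ι (length (filter P? (row List.++ rows)))
      ≡⟨ ≡.cong (ι ∘ length) (List.filter-++ P? row rows) ⟩
    ι (length (filter P? row List.++ filter P? rows))
      ≡⟨ ≡.cong ι (List.length-++ (filter P? row)) ⟩
    ι (length (filter P? row) ℕ.+ length (filter P? rows))
      ≈⟨ ×-homo-+ 1# (length (filter P? row)) _ ⟩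
    ι (length (filter P? row)) + ι (length (filter P? rows))
      ≡⟨ ≡.cong (λ xs → ι (length (filter P? xs)) + ι (length (filter P? rows)))
           (List.map-tabulate g (f zero ,_)) ⟩
    ι (length (filter P? (List.tabulate (λ j → f zero , g j)))) + ι (length (filter P? rows))
      ≈⟨ +-cong (ι-length-filter P? (λ j → f zero , g j))
                (ι-length-filter-cartesianProduct P? (f ∘ suc) g) ⟩
    sum (λ i → sum (λ j → indicator (does (P? (f i , g j))))) ∎
    where
    row  = List.map (f zero ,_) (List.tabulate g)
    rows = cartesianProduct (List.tabulate (f ∘ suc)) (List.tabulate g)

  ι-sum : ∀ {n} (f : Fin n → ℕ) →
          ι (SemiringSum.sum ℕ.+-*-semiring f) ≈ sum (λ i → ι (f i))
  ι-sum {zero}  f = refl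
  ι-sum {suc n} f = trans (×-homo-+ 1# (f zero) _) (+-congˡ (ι-sum (f ∘ suc)))

  ι-square : ∀ m → ι (m ℕ.^ 2) ≈ ι m * ι m
  ι-square m = begin
    ι (m ℕ.* (m ℕ.* 1)) ≡⟨ ≡.cong (λ k → ι (m ℕ.* k)) (ℕ.*-identityʳ m) ⟩
    ι (m ℕ.* m)         ≈⟨ ×1-homo-* m m ⟩
    ι m * ι m           ∎

  sum-diagonal : ∀ {n} (d : Vector Carrier n) i → sum (diagonal d i) ≈ d i
  sum-diagonal {suc n} d zero    = trans (+-congˡ (sum-replicate-zero n)) (+-identityʳ (d zero))
  sum-diagonal {suc n} d (suc i) = trans (+-identityˡ _) (sum-diagonal (d ∘ suc) i)

  module _ {n} (G : Graph n) where
    open Graph G hiding (sym)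

    private
      a : Fin n → Fin n → Carrier
      a = adjacencyMatrix G

    adjacency-symmetric : ∀ i j → a i j ≡ a j i
    adjacency-symmetric i j with adj? i j | adj? j i
    ... | yes _  | yes _  = ≡.refl
    ... | no  _  | no  _  = ≡.refl
    ... | yes ij | no ¬ji = contradiction (Graph.sym G ij) ¬ji
    ... | no ¬ij | yes ji = contradiction (Graph.sym G ji) ¬ij

    adjacency-irreflexive : ∀ i → a i i ≡ 0#
    adjacency-irreflexive i = ≡.cong indicator (dec-false (adj? i i) (irrefl ≡.refl))

    sum-adjacency : ∀ i → sum (a i) ≈ ι (degree i)
    sum-adjacency i = sym (ι-length-filter (adj? i) (λ j → j))

    private
      upper : Fin n → Fin n → Carrier
      upper i j = indicator (does ((i Fin.<? j) ×-dec adj? i j))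

    adjacency-split : ∀ i j → a i j ≈ upper i j + upper j i
    adjacency-split i j with Fin.<-cmp i j
    ... | tri< i<j _ ¬j<i = begin
      a i j         ≈⟨ +-identityʳ _ ⟨
      a i j + 0#    ≡⟨ ≡.cong₂ (λ b b′ → indicator (b ∧ does (adj? i j)) + indicator (b′ ∧ does (adj? j i)))
                         (dec-true (i Fin.<? j) i<j) (dec-false (j Fin.<? i) ¬j<i) ⟨
      upper i j + upper j i ∎
    ... | tri> ¬i<j _ j<i = begin
      a i j         ≡⟨ adjacency-symmetric i j ⟩
      a j i         ≈⟨ +-identityˡ _ ⟨
      0# + a j i    ≡⟨ ≡.cong₂ (λ b b′ → indicator (b ∧ does (adj? i j)) + indicator (b′ ∧ does (adj? j i)))
                         (dec-false (i Fin.<? j) ¬i<j) (dec-true (j Fin.<? i) j<i) ⟨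
      upper i j + upper j i ∎
    ... | tri≈ ¬i<i ≡.refl _ = begin
      a i i         ≡⟨ adjacency-irreflexive i ⟩
      0#            ≈⟨ +-identityʳ 0# ⟨
      0# + 0#       ≡⟨ ≡.cong (λ b → indicator (b ∧ does (adj? i i)) + indicator (b ∧ does (adj? i i)))
                         (dec-false (i Fin.<? i) ¬i<i) ⟨
      upper i i + upper i i ∎

    -- The degrees add up the whole adjacency matrix, whereas `size` counts its strictly upper part.
    -- The strictly lower part is the transpose of that, and exchanging the order of summation shows
    -- that it has the same sum.
    handshake : sum (λ i → ι (degree i)) ≈ ι 2 * ι size
    handshake = begin
      sum (λ i → ι (degree i))
        ≈⟨ sum-cong-≋ sum-adjacency ⟨
      sum (λ i → sum (a i))
        ≈⟨ sum-cong-≋ (λ i → trans (sum-cong-≋ (adjacency-split i))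
             (∑-distrib-+ (upper i) (λ j → upper j i))) ⟩
      sum (λ i → sum (upper i) + sum (λ j → upper j i))
        ≈⟨ ∑-distrib-+ (λ i → sum (upper i)) (λ i → sum (λ j → upper j i)) ⟩
      sum (λ i → sum (upper i)) + sum (λ i → sum (λ j → upper j i))
        ≈⟨ +-congˡ (∑-comm (λ i j → upper j i)) ⟩
      sum (λ i → sum (upper i)) + sum (λ i → sum (upper i))
        ≈⟨ solve 1 (λ s → s :+ s := con (pos 2) :* s) refl _ ⟩
      ι 2 * sum (λ i → sum (upper i))
        ≈⟨ *-congˡ (ι-length-filter-cartesianProduct
             (λ (u , v) → (u Fin.<? v) ×-dec adj? u v) (λ i → i) (λ j → j)) ⟨
      ι 2 * ι size ∎

    module _ (α : Carrier) where
      private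
        D : Fin n → Carrier
        D i = ι (degree i)

      A[α]-diagonal : ∀ i → (A[_] G α) i i ≈ α * D i
      A[α]-diagonal i = begin
        α * diagonal D i i + (1# - α) * a i i
          ≡⟨ ≡.cong₂ (λ x y → α * x + (1# - α) * y) (diagonal-on D i) (adjacency-irreflexive i) ⟩
        α * D i + (1# - α) * 0#
          ≈⟨ trans (+-congˡ (zeroʳ _)) (+-identityʳ _) ⟩
        α * D i ∎

      trace-A[α] : trace (A[_] G α) ≈ ι 2 * α * ι size
      trace-A[α] = begin
        trace (A[_] G α)    ≈⟨ sum-cong-≋ A[α]-diagonal ⟩
        sum (λ i → α * D i) ≈⟨ *-distribˡ-sum α D ⟨
        α * sum D           ≈⟨ *-congˡ handshake ⟩
        α * (ι 2 * ι size)  ≈⟨ solve 2 (λ a m → a :* (con (pos 2) :* m) := con (pos 2) :* a :* m) refl α (ι size) ⟩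
        ι 2 * α * ι size    ∎

      A[α]-off : ∀ {i j} → i ≢ j → (A[_] G α) i j ≈ (1# - α) * a i j
      A[α]-off {i} {j} i≢j = begin
        α * diagonal D i j + (1# - α) * a i j
          ≡⟨ ≡.cong (λ x → α * x + (1# - α) * a i j) (diagonal-off D i≢j) ⟩
        α * 0# + (1# - α) * a i j
          ≈⟨ trans (+-congʳ (zeroʳ α)) (+-identityˡ _) ⟩
        (1# - α) * a i j ∎

      private
        E : Fin n → Carrier
        E i = α ^ 2 * (D i * D i)

      -- The degree matrix and the adjacency matrix have disjoint supports, so no cross terms arise.
      -- Entries of the adjacency matrix are idempotent, which makes the second part linear in it,
      -- so its row sums are degrees again.
      A[α]-square : ∀ i j → (A[_] G α) i j * (A[_] G α) j i ≈
        diagonal (λ v → α ^ 2 * (ι (degree v) * ι (degree v))) i j + (1# - α) ^ 2 * a i j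
      A[α]-square i j = by-cases (i Fin.≟ j)
        where
        by-cases : Dec (i ≡ j) → (A[_] G α) i j * (A[_] G α) j i ≈
                                 diagonal E i j + (1# - α) ^ 2 * a i j
        by-cases (yes ≡.refl) = begin
          (A[_] G α) i i * (A[_] G α) i i
            ≈⟨ *-cong (A[α]-diagonal i) (A[α]-diagonal i) ⟩
          α * D i * (α * D i)
            ≈⟨ solve 3 (λ α d β → α :* d :* (α :* d) := α :^ 2 :* (d :* d) :+ β :^ 2 :* con (pos 0))
                 refl α (D i) (1# - α) ⟩
          E i + (1# - α) ^ 2 * 0#
            ≡⟨ ≡.cong₂ (λ x y → x + (1# - α) ^ 2 * y) (diagonal-on E i) (adjacency-irreflexive i) ⟨
          diagonal E i i + (1# - α) ^ 2 * a i i ∎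
        by-cases (no i≢j) = begin
          (A[_] G α) i j * (A[_] G α) j i
            ≈⟨ *-cong (A[α]-off i≢j) (A[α]-off (i≢j ∘ ≡.sym)) ⟩
          (1# - α) * a i j * ((1# - α) * a j i)
            ≡⟨ ≡.cong (λ x → (1# - α) * a i j * ((1# - α) * x)) (adjacency-symmetric j i) ⟩
          (1# - α) * a i j * ((1# - α) * a i j)
            ≈⟨ solve 2 (λ β x → β :* x :* (β :* x) := β :^ 2 :* (x :* x)) refl (1# - α) (a i j) ⟩
          (1# - α) ^ 2 * (a i j * a i j)
            ≈⟨ *-congˡ (indicator-idem (does (adj? i j))) ⟩
          (1# - α) ^ 2 * a i j
            ≈⟨ +-identityˡ _ ⟨
          0# + (1# - α) ^ 2 * a i j
            ≡⟨ ≡.cong (λ x → x + (1# - α) ^ 2 * a i j) (diagonal-off E i≢j) ⟨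
          diagonal E i j + (1# - α) ^ 2 * a i j ∎

      trace²-A[α] : trace² (A[_] G α) ≈ α ^ 2 * ι firstZagreb + ι 2 * ι size * (1# - α) ^ 2
      trace²-A[α] = begin
        trace² (A[_] G α)
          ≈⟨ sum-cong-≋ (λ i → trans (sum-cong-≋ (A[α]-square i))
               (trans (∑-distrib-+ (diagonal E i) (λ j → (1# - α) ^ 2 * a i j))
                 (+-cong (sum-diagonal E i)
                   (trans (sym (*-distribˡ-sum ((1# - α) ^ 2) (a i)))
                     (*-congˡ (sum-adjacency i)))))) ⟩
        sum (λ i → E i + (1# - α) ^ 2 * D i)
          ≈⟨ ∑-distrib-+ E (λ i → (1# - α) ^ 2 * D i) ⟩
        sum E + sum (λ i → (1# - α) ^ 2 * D i)
          ≈⟨ +-cong (*-distribˡ-sum (α ^ 2) (λ i → D i * D i)) (*-distribˡ-sum ((1# - α) ^ 2) D) ⟨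
        α ^ 2 * sum (λ i → D i * D i) + (1# - α) ^ 2 * sum D
          ≈⟨ +-cong (*-congˡ (trans (ι-sum (λ v → degree v ℕ.^ 2))
                                    (sum-cong-≋ (λ i → ι-square (degree i)))))
                    (trans (*-comm _ _) (*-congˡ (sym handshake))) ⟨
        α ^ 2 * ι firstZagreb + ι 2 * ι size * (1# - α) ^ 2 ∎

-- Order without decidability, square roots and Cauchy-Schwarz.

module Inequalities {c ℓ₁ ℓ₂ ℓ₃} (R : Reals c ℓ₁ ℓ₂ ℓ₃) where
  open Reals R
  open IntegerCoefficients commutativeRing
  open IsStrictPartialOrder isStrictPartialOrder using (<-respʳ-≈; <-respˡ-≈)
    renaming (trans to <-trans; irrefl to <-irrefl)
  open SemiringSum semiring
    using (sum-cong-≋; ∑-distrib-+; *-distribˡ-sum)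

  -- The constructive substitute for trichotomy: apartness is cotransitive, and when the resulting
  -- comparison points the wrong way, transitivity with x < y yields the other alternative.
  <-cotrans : ∀ {x y} → x < y → ∀ z → x < z ⊎ z < y
  <-cotrans x<y z with #-cotrans (<⇒# x<y) z
  ... | inj₁ x#z with #⇒<⊎> x#z
  ...   | inj₁ x<z = inj₁ x<z
  ...   | inj₂ z<x = inj₂ (<-trans z<x x<y)
  <-cotrans x<y z | inj₂ z#y with #⇒<⊎> z#y
  ...   | inj₁ z<y = inj₂ z<y
  ...   | inj₂ y<z = inj₁ (<-trans x<y y<z)

  ≤-resp-≈ : ∀ {x y x′ y′} → x ≈ x′ → y ≈ y′ → x ≤ y → x′ ≤ y′
  ≤-resp-≈ x≈x′ y≈y′ x≤y y′<x′ =
    x≤y (<-respˡ-≈ (sym y≈y′) (<-respʳ-≈ (sym x≈x′) y′<x′))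

  ≤-trans : ∀ {x y z} → x ≤ y → y ≤ z → x ≤ z
  ≤-trans {y = y} x≤y y≤z z<x with <-cotrans z<x y
  ... | inj₁ z<y = y≤z z<y
  ... | inj₂ y<x = x≤y y<x

  x<y⇒0<y-x : ∀ {x y} → x < y → 0# < y - x
  x<y⇒0<y-x {x} x<y = <-respˡ-≈ (-‿inverseʳ x) (+-monoˡ-< (- x) x<y)

  0<y-x⇒x<y : ∀ {x y} → 0# < y - x → x < y
  0<y-x⇒x<y {x} {y} 0<y-x = <-respˡ-≈ (+-identityˡ x)
    (<-respʳ-≈ (solve 2 (λ x y → y :- x :+ x := y) refl x y) (+-monoˡ-< x 0<y-x))

  0≤y-x⇒x≤y : ∀ {x y} → 0# ≤ y - x → x ≤ y
  0≤y-x⇒x≤y {x} {y} 0≤y-x y<x = 0≤y-x (0<y-x⇒x<y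
    (<-respʳ-≈ (solve 2 (λ x y → x :- y := con (pos 0) :- (y :- x)) refl x y) (x<y⇒0<y-x y<x)))

  <0⇒0<- : ∀ {x} → x < 0# → 0# < - x
  <0⇒0<- {x} x<0 = <-respʳ-≈ (+-identityˡ (- x)) (x<y⇒0<y-x x<0)

  +-pos-nonNeg : ∀ {x y} → 0# < x → 0# ≤ y → 0# < x + y
  +-pos-nonNeg {x} {y} 0<x 0≤y
    with <-cotrans (<-respˡ-≈ (+-identityˡ y) (+-monoˡ-< y 0<x)) 0#
  ... | inj₁ y<0   = contradiction y<0 0≤y
  ... | inj₂ 0<x+y = 0<x+y

  +-nonNeg : ∀ {x y} → 0# ≤ x → 0# ≤ y → 0# ≤ x + y
  +-nonNeg {x} {y} 0≤x 0≤y x+y<0 with <-cotrans x+y<0 y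
  ... | inj₂ y<0   = 0≤y y<0
  ... | inj₁ x+y<y = 0≤x (0<y-x⇒x<y
    (<-respʳ-≈ (solve 2 (λ x y → y :- (x :+ y) := con (pos 0) :- x) refl x y) (x<y⇒0<y-x x+y<y)))

  -- The sign of x cannot be decided, but under x² < 0 neither sign is possible. Tightness then
  -- gives x ≈ 0, which contradicts x² < 0.
  square-nonNeg : ∀ x → 0# ≤ x * x
  square-nonNeg x x*x<0 = <-irrefl (trans (*-congʳ x≈0) (zeroˡ x)) x*x<0
    where
    x≈0 : x ≈ 0#
    x≈0 = proj₁ (tight x 0#) λ x#0 → case (#⇒<⊎> x#0)
      where
      case : ¬ (x < 0# ⊎ 0# < x)
      case (inj₂ 0<x) = <-irrefl refl (<-trans x*x<0 (*-pos 0<x 0<x))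
      case (inj₁ x<0) = <-irrefl refl (<-trans x*x<0
        (<-respʳ-≈ (solve 1 (λ x → :- x :* :- x := x :* x) refl x)
          (*-pos (<0⇒0<- x<0) (<0⇒0<- x<0))))

  sum-nonNeg : ∀ {n} {f : Vector Carrier n} → (∀ i → 0# ≤ f i) → 0# ≤ sum f
  sum-nonNeg {zero}  p = <-irrefl refl
  sum-nonNeg {suc n} p = +-nonNeg (p zero) (sum-nonNeg (p ∘ suc))

  *-cancelˡ-nonNeg : ∀ {x y} → 0# < x → 0# ≤ x * y → 0# ≤ y
  *-cancelˡ-nonNeg {x} {y} 0<x 0≤xy y<0 = 0≤xy (0<y-x⇒x<y
    (<-respʳ-≈ (solve 2 (λ x y → x :* :- y := con (pos 0) :- x :* y) refl x y)
      (*-pos 0<x (<0⇒0<- y<0))))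

  -- If √y < x, then x² - y = (x - √y)(x + √y) is positive: the second factor is (x - √y) + 2√y, a
  -- positive number plus a non-negative one.
  square≤⇒≤√ : ∀ {x y} → x * x ≤ y → x ≤ √ y
  square≤⇒≤√ {x} {y} x²≤y √y<x = x²≤y (0<y-x⇒x<y (<-respʳ-≈
    (trans (solve 2 (λ x r → (x :- r) :* (x :- r :+ (r :+ r)) := x :* x :- r :* r) refl x (√ y))
           (+-congˡ (-‿cong (√-square 0≤y))))
    (*-pos 0<x-√y (+-pos-nonNeg 0<x-√y (+-nonNeg (√-nonNeg 0≤y) (√-nonNeg 0≤y))))))
    where
    0≤y : 0# ≤ y
    -- `√` is unspecified at negative arguments. The bound itself certifies that the radicand is
    -- non-negative, also for the radicand of the theorem.
    0≤y = ≤-trans (square-nonNeg x) x²≤y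

    0<x-√y : 0# < x - √ y
    0<x-√y = x<y⇒0<y-x √y<x

  x-y≤z⇒x≤y+z : ∀ {x y z} → x - y ≤ z → x ≤ y + z
  x-y≤z⇒x≤y+z {x} {y} {z} x-y≤z y+z<x = x-y≤z (0<y-x⇒x<y (<-respʳ-≈
    (solve 3 (λ x y z → x :- (y :+ z) := x :- y :- z) refl x y z) (x<y⇒0<y-x y+z<x)))

  sum-affine : ∀ {n} a b c (f g h : Vector Carrier n) →
    sum (λ i → a * f i + b * g i + c * h i) ≈ a * sum f + b * sum g + c * sum h
  sum-affine a b c f g h =
    trans (∑-distrib-+ (λ i → a * f i + b * g i) (λ i → c * h i))
      (+-cong
        (trans (∑-distrib-+ (λ i → a * f i) (λ i → b * g i))
          (sym (+-cong (*-distribˡ-sum a f) (*-distribˡ-sum b g))))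
        (sym (*-distribˡ-sum c h)))

  -- Expanding 0 ≤ Σ (A v − C w)², where A = Σ w² and C = Σ w v.
  cauchy-schwarz : ∀ {n} (w v : Vector Carrier n) → 0# < sum (λ i → w i * w i) →
    sum (λ i → w i * v i) * sum (λ i → w i * v i) ≤
    sum (λ i → w i * w i) * sum (λ i → v i * v i)
  cauchy-schwarz w v 0<A = 0≤y-x⇒x≤y (*-cancelˡ-nonNeg 0<A
    (≤-resp-≈ refl expand (sum-nonNeg λ i → square-nonNeg (A * v i - C * w i))))
    where
    A B C : Carrier
    A = sum λ i → w i * w i
    B = sum λ i → v i * v i
    C = sum λ i → w i * v i

    expand : sum (λ i → (A * v i - C * w i) * (A * v i - C * w i)) ≈ A * (A * B - C * C)
    expand = trans
      (sum-cong-≋ λ i → solve 4 (λ a c w v → (a :* v :- c :* w) :* (a :* v :- c :* w) :=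
          a :* a :* (v :* v) :+ :- (con (pos 2) :* a :* c) :* (w :* v) :+ c :* c :* (w :* w))
        refl A C (w i) (v i))
      (trans (sum-affine (A * A) (- (ι 2 * A * C)) (C * C)
                (λ i → v i * v i) (λ i → w i * v i) (λ i → w i * w i))
        (solve 3 (λ a b c → a :* a :* b :+ :- (con (pos 2) :* a :* c) :* c :+ c :* c :* a :=
                            a :* (a :* b :- c :* c)) refl A B C))

-- Centred vectors and the deviation of S_k from its mean share.

module PartialSums {c ℓ₁ ℓ₂ ℓ₃} (R : Reals c ℓ₁ ℓ₂ ℓ₃) where
  open Reals R
  open RealMatrices R
  open IntegerCoefficients commutativeRing
  open GraphMatrices R
  open Inequalities R
  open IsStrictPartialOrder isStrictPartialOrder using (<-respʳ-≈)
    renaming (trans to <-trans; irrefl to <-irrefl)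
  open SemiringSum semiring
    using (sum-cong-≋; sum-replicate; ∑-distrib-+)
  open SemiringMult semiring using (×-homo-+; ×-congʳ; ×-comm-*)
  open import Relation.Binary.Reasoning.Setoid setoid

  -- The inverse used inside `_/ℕ_`, so that `x /ℕ n` unfolds to `x * 1/ n`.
  1/ : (n : ℕ) .{{_ : NonZero n}} → Carrier
  1/ n = proj₁ (#⇒invertible (#-sym (<⇒# (ι-pos n))))

  ι*1/≈1 : ∀ n .{{_ : NonZero n}} → ι n * 1/ n ≈ 1#
  ι*1/≈1 n = trans (*-congʳ (solve 1 (λ x → x := x :- con (pos 0)) refl (ι n)))
    (proj₂ (proj₂ (#⇒invertible (#-sym (<⇒# (ι-pos n))))))

  -- An invertible element is apart from 0 and so has a sign; were it negative, n · (-1/n) = -1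
  -- would be positive.
  1/-pos : ∀ n .{{_ : NonZero n}} → 0# < 1/ n
  1/-pos n with #⇒<⊎> 1/n#0
    where
    1/n#0 : 1/ n # 0#
    1/n#0 = invertible⇒# (ι n , ι*[1/-0]≈1 , trans (*-comm _ _) ι*[1/-0]≈1)
      where
      ι*[1/-0]≈1 : ι n * (1/ n - 0#) ≈ 1#
      ι*[1/-0]≈1 = trans (solve 2 (λ x y → x :* (y :- con (pos 0)) := x :* y) refl (ι n) (1/ n))
                         (ι*1/≈1 n)
  ... | inj₂ 0<1/n = 0<1/n
  ... | inj₁ 1/n<0 = contradiction (*-pos (ι-pos n) (<0⇒0<- 1/n<0)) λ 0<-1 →
    <-irrefl refl (<-trans (<-respʳ-≈
      (trans (solve 2 (λ x y → x :* :- y := :- (x :* y)) refl (ι n) (1/ n)) (-‿cong (ι*1/≈1 n))) 0<-1)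
      (0<y-x⇒x<y (<-respʳ-≈ (solve 0 (:1 := con (pos 0) :- :- :1) refl) 0<1)))

  ι-∸ : ∀ {k n} → k ℕ.≤ n → ι (n ∸ k) ≈ ι n - ι k
  ι-∸ {k} {n} k≤n = begin
    ι (n ∸ k)               ≈⟨ solve 2 (λ x y → x := x :+ y :- y) refl (ι (n ∸ k)) (ι k) ⟩
    ι (n ∸ k) + ι k - ι k   ≈⟨ +-congʳ (×-homo-+ 1# (n ∸ k) k) ⟨
    ι (n ∸ k ℕ.+ k) - ι k   ≡⟨ ≡.cong (λ m → ι m - ι k) (ℕ.m∸n+n≡m k≤n) ⟩
    ι n - ι k               ∎

  sum-const : ∀ n a → sum {n} (λ _ → a) ≈ a * ι n
  sum-const n a = begin
    sum {n} (λ _ → a)      ≈⟨ sum-replicate n ⟩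
    n · a                  ≈⟨ ×-congʳ n (*-identityʳ a) ⟨
    n · (a * 1#)           ≈⟨ ×-comm-* n a 1# ⟨
    a * ι n                ∎

  module _ (n : ℕ) .{{_ : NonZero n}} where
    mean : Vector Carrier n → Carrier
    mean f = sum f * 1/ n

    covariance : ∀ f g → sum (λ i → (f i - mean f) * (g i - mean g)) ≈
                         sum (λ i → f i * g i) - sum f * sum g * 1/ n
    covariance f g = begin
      sum (λ i → (f i - mean f) * (g i - mean g))
        ≈⟨ sum-cong-≋ (λ i → solve 4 (λ f g a b → (f :- a) :* (g :- b) :=
             :1 :* (f :* g) :+ :- b :* f :+ :- a :* g :+ a :* b) refl (f i) (g i) (mean f) (mean g)) ⟩
      sum (λ i → 1# * (f i * g i) + - mean g * f i + - mean f * g i + mean f * mean g)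
        ≈⟨ ∑-distrib-+ (λ i → 1# * (f i * g i) + - mean g * f i + - mean f * g i)
                       (λ _ → mean f * mean g) ⟩
      sum (λ i → 1# * (f i * g i) + - mean g * f i + - mean f * g i) + sum {n} (λ _ → mean f * mean g)
        ≈⟨ +-cong (sum-affine 1# (- mean g) (- mean f) (λ i → f i * g i) f g)
                  (sum-const n (mean f * mean g)) ⟩
      1# * sum (λ i → f i * g i) + - mean g * sum f + - mean f * sum g + mean f * mean g * ι n
        -- That m ν = 1 is not a ring identity, so the solver isolates its defect m ν - 1 as a
        -- factor, which the next step replaces by 0.
        ≈⟨ solve 5 (λ p f g ν m →
             :1 :* p :+ :- (g :* ν) :* f :+ :- (f :* ν) :* g :+ f :* ν :* (g :* ν) :* m :=
             p :- f :* g :* ν :+ (m :* ν :- :1) :* (f :* g :* ν))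
             refl (sum (λ i → f i * g i)) (sum f) (sum g) (1/ n) (ι n) ⟩
      sum (λ i → f i * g i) - sum f * sum g * 1/ n + (ι n * 1/ n - 1#) * (sum f * sum g * 1/ n)
        ≈⟨ +-congˡ (trans (*-congʳ (trans (+-congʳ (ι*1/≈1 n)) (-‿inverseʳ 1#))) (zeroˡ _)) ⟩
      sum (λ i → f i * g i) - sum f * sum g * 1/ n + 0#
        ≈⟨ +-identityʳ _ ⟩
      sum (λ i → f i * g i) - sum f * sum g * 1/ n ∎

  first : ∀ {n} → ℕ → Vector Carrier n
  first k i = indicator (does (toℕ i ℕ.<? k))

  sum-first : ∀ {n k} → k ℕ.≤ n → sum (first {n} k) ≈ ι k
  sum-first {zero}  ℕ.z≤n       = refl
  sum-first {suc n} ℕ.z≤n       = trans (+-identityˡ _) (sum-first {n} ℕ.z≤n)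
  sum-first {suc n} (ℕ.s≤s k≤n) = +-congˡ (sum-first k≤n)

  S≈ : ∀ {n} k (λs : Vector Carrier n) → S k λs ≈ sum (λ i → first k i * λs i)
  S≈ k λs = sum-cong-≋ λ i → indicator-*ʳ (does (toℕ i ℕ.<? k)) (λs i)

  S-deviation : ∀ n .{{_ : NonZero n}} k → 1 ℕ.≤ k → k ℕ.≤ n ∸ 1 → (λs : Vector Carrier n) →
    let d = S k λs - ι k * sum λs * 1/ n in
    d * d ≤ ι k * (ι n - ι k) * 1/ n *
            (sum (λ i → λs i * λs i) - sum λs * sum λs * 1/ n)
  S-deviation n@(suc n-1) k@(suc _) 1≤k k≤n-1 λs =
    ≤-resp-≈ (*-cong C≈ C≈) (*-cong A≈ (covariance n λs λs)) (cauchy-schwarz w v 0<A)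
    where
    k≤n : k ℕ.≤ n
    k≤n = ℕ.m≤n⇒m≤1+n k≤n-1

    χ w v : Vector Carrier n
    χ = first k
    w i = χ i - mean n χ
    v i = λs i - mean n λs

    C≈ : sum (λ i → w i * v i) ≈ S k λs - ι k * sum λs * 1/ n
    C≈ = trans (covariance n χ λs)
      (+-cong (sym (S≈ k λs)) (-‿cong (*-congʳ (*-congʳ (sum-first k≤n)))))

    A≈ : sum (λ i → w i * w i) ≈ ι k * (ι n - ι k) * 1/ n
    A≈ = begin
      sum (λ i → w i * w i)
        ≈⟨ covariance n χ χ ⟩
      sum (λ i → χ i * χ i) - sum χ * sum χ * 1/ n
        ≈⟨ +-cong (trans (sum-cong-≋ {n} λ i → indicator-idem (does (toℕ i ℕ.<? k))) (sum-first k≤n))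
                  (-‿cong (*-congʳ (*-cong (sum-first k≤n) (sum-first k≤n)))) ⟩
      ι k - ι k * ι k * 1/ n
        ≈⟨ +-congʳ (trans (*-congˡ (ι*1/≈1 n)) (*-identityʳ (ι k))) ⟨
      ι k * (ι n * 1/ n) - ι k * ι k * 1/ n
        ≈⟨ solve 3 (λ k n ν → k :* (n :* ν) :- k :* k :* ν := k :* (n :- k) :* ν)
             refl (ι k) (ι n) (1/ n) ⟩
      ι k * (ι n - ι k) * 1/ n ∎

    0<n-k : 0# < ι n - ι k
    0<n-k = <-respʳ-≈ (ι-∸ k≤n)
      (ι-pos (n ∸ k) {{ℕ.>-nonZero (ℕ.m<n⇒0<n∸m (ℕ.s≤s k≤n-1))}})

    0<A : 0# < sum (λ i → w i * w i)
    -- Both bounds on k enter here: for k = 0 or k = n the indicator is constant, its centred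
    -- version vanishes, and Cauchy-Schwarz could not cancel the norm.
    0<A = <-respʳ-≈ (sym A≈) (*-pos (*-pos (ι-pos k) 0<n-k) (1/-pos n))

theorem3p2 : ∀ {c ℓ₁ ℓ₂ ℓ₃} (R : Reals c ℓ₁ ℓ₂ ℓ₃) →
    let open Reals R
        open RealMatrices R
    in
    (α : Carrier) → 1# /ℕ 2 ≤ α → α < 1# →
    (n : ℕ) .{{_ : NonZero n}} (G : Graph n) →
    (k : ℕ) → 1 ℕ.≤ k → k ℕ.≤ n ∸ 1 →
    (λs : Vector Carrier n) → Eigenvalues (A[_] G α) λs →
    let m  = ι (Graph.size G)
        Z₁ = ι (Graph.firstZagreb G)
    in
    S k λs ≤
      ι 2 * α * ι k * m /ℕ n
      + √ (ι k * (ι n - ι k) /ℕ n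
           * (α ^ 2 * Z₁ + ι 2 * m * (1# - α) ^ 2 - ι 4 * α ^ 2 * m ^ 2 /ℕ n))
theorem3p2 R α _ _ n G k 1≤k k≤n-1 λs eigen =
  x-y≤z⇒x≤y+z (square≤⇒≤√ (≤-resp-≈ (*-cong deviation deviation) (*-congˡ variance)
    (S-deviation n k 1≤k k≤n-1 λs)))
  where
  open Reals R
  open RealMatrices R
  open IntegerCoefficients commutativeRing
  open CharacteristicPolynomials R using (sum-eigenvalues; sum-squares-eigenvalues)
  open GraphMatrices R using (trace-A[α]; trace²-A[α])
  open Inequalities R
  open PartialSums R

  m Z₁ T : Carrier
  m  = ι (Graph.size G)
  Z₁ = ι (Graph.firstZagreb G)
  T  = ι 2 * α * m

  sum≈T : sum λs ≈ T
  sum≈T = trans (sum-eigenvalues eigen) (trace-A[α] G α)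

  deviation : S k λs - ι k * sum λs * 1/ n ≈ S k λs - ι 2 * α * ι k * m /ℕ n
  deviation = +-congˡ (-‿cong (*-congʳ (trans (*-congˡ sum≈T)
    (solve 3 (λ k α m → k :* (con (pos 2) :* α :* m) := con (pos 2) :* α :* k :* m)
      refl (ι k) α m))))

  variance : sum (λ i → λs i * λs i) - sum λs * sum λs * 1/ n ≈
             α ^ 2 * Z₁ + ι 2 * m * (1# - α) ^ 2 - ι 4 * α ^ 2 * m ^ 2 /ℕ n
  variance = +-cong (trans (sum-squares-eigenvalues eigen) (trace²-A[α] G α))
    (-‿cong (*-congʳ (trans (*-cong sum≈T sum≈T)
      (solve 2 (λ α m → con (pos 2) :* α :* m :* (con (pos 2) :* α :* m) :=
                        con (pos 4) :* α :^ 2 :* m :^ 2) refl α m))))
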